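{- Let $\lambda/\mu$ be a skew shape with $r$ rows and $c$ columns and let $\mathcal{R}_{\lambda/\mu}$ be its rook matroid. Then $\mathcal{R}_{\lambda/\mu}$ is sort-closed: for any two bases $I,J$ of $\mathcal{R}_{\lambda/\mu}$, both $\mathrm{sort}_1(I,J)$ and $\mathrm{sort}_2(I,J)$ are bases of $\mathcal{R}_{\lambda/\mu}$. In particular, $\mathcal{R}_{\lambda/\mu}$ is a positroid.
   Context: Rows of $\lambda/\mu$ are labelled $1,\dots,r$ top to bottom, columns $r+1,\dots,r+c$ left to right; the skew shape is the set of cells $\{(i,r+j):1\le i\le r,\ \mu_i<j\le\lambda_i\}$, every row and column assumed nonempty. A non-nesting rook placement is a set of cells no two of which share a row or column and no two of which $(i,j),(k,\ell)$ satisfy $i<k$, $j<\ell$. For such $\rho$, $R(\rho)$ is its set of occupied rows and $C(\rho)$ its set of unoccupied columns. The rook matroid $\mathcal{R}_{\lambda/\mu}$ is the matroid on $[r+c]$ whose bases are the sets $R(\rho)\cup C(\rho)$ for $\rho$ ranging over non-nesting rook placements on $\lambda/\mu$. Sorting: for $I,J\in\binom{[n]}{k}$ write the multiset union as $a_1\le b_1\le a_2\le b_2\le\cdots\le a_k\le b_k$ and set $\mathrm{sort}_1(I,J)=\{a_1,\dots,a_k\}$, $\mathrm{sort}_2(I,J)=\{b_1,\dots,b_k\}$. A positroid is a matroid representable by a real matrix all of whose maximal minors are nonnegative. -}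

module Defs where

open import Data.Nat using (ℕ; zero; suc; _+_; _≤_; _<_; _≤?_)
open import Data.Fin using (Fin; toℕ)
open import Data.List using (List; []; _∷_; merge)
open import Data.List.Membership.Propositional using (_∈_)
open import Data.List.Relation.Unary.Linked using (Linked)
open import Data.Product using (Σ; ∃; _×_; _,_; proj₁; proj₂)
open import Data.Sum using (_⊎_)
open import Relation.Nullary using (¬_)
open import Relation.Binary.PropositionalEquality using (_≡_)
open import Function.Bundles using (_⇔_)

-- The parts are indexed by
-- Fin r: row i (1 ≤ i ≤ r) corresponds to index k with i = suc (toℕ k).
-- λ, μ are partitions (weakly decreasing), λ has parts ≤ c, and every row
-- and every column 1..c of λ/μ is nonempty.
record SkewShape (r c : ℕ) : Set where
  field
    lam mu      : Fin r → ℕ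
    lam-decr    : ∀ (k l : Fin r) → toℕ k ≤ toℕ l → lam l ≤ lam k
    mu-decr     : ∀ (k l : Fin r) → toℕ k ≤ toℕ l → mu l ≤ mu k
    lam-≤c      : ∀ (k : Fin r) → lam k ≤ c
    row-nonempty : ∀ (k : Fin r) → mu k < lam k
    col-nonempty : ∀ (j : ℕ) → 1 ≤ j → j ≤ c → ∃ λ (k : Fin r) → mu k < j × j ≤ lam k

open SkewShape public

-- Cells are pairs (row, column) with rows labelled 1..r and columns r+1..r+c.
Cell : Set
Cell = ℕ × ℕ

InShape : ∀ {r c} → SkewShape r c → Cell → Set
InShape {r} S (i , j) =
  Σ (Fin r) λ k → i ≡ suc (toℕ k) × r + mu S k < j × j ≤ r + lam S k

record NonNestingRookPlacement {r c} (S : SkewShape r c) (ρ : List Cell) : Set where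
  field
    inShape    : ∀ {p} → p ∈ ρ → InShape S p
    rowDistinct : ∀ {p q} → p ∈ ρ → q ∈ ρ → proj₁ p ≡ proj₁ q → p ≡ q
    colDistinct : ∀ {p q} → p ∈ ρ → q ∈ ρ → proj₂ p ≡ proj₂ q → p ≡ q
    nonNesting : ∀ {p q} → p ∈ ρ → q ∈ ρ → ¬ (proj₁ p < proj₁ q × proj₂ p < proj₂ q)

InRC : (r c : ℕ) → List Cell → ℕ → Set
InRC r c ρ x =
  (∃ λ (p : Cell) → p ∈ ρ × proj₁ p ≡ x)
  ⊎ (r < x × x ≤ r + c × (∀ (p : Cell) → p ∈ ρ → ¬ (proj₂ p ≡ x)))

-- Subsets of [r+c] are represented by strictly increasing lists of naturals.
StrictlyIncreasing : List ℕ → Set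
StrictlyIncreasing = Linked _<_

IsRookBasis : ∀ {r c} → SkewShape r c → List ℕ → Set
IsRookBasis {r} {c} S B =
  StrictlyIncreasing B ×
  ∃ λ (ρ : List Cell) → NonNestingRookPlacement S ρ ×
    (∀ (x : ℕ) → (x ∈ B) ⇔ InRC r c ρ x)

odds : List ℕ → List ℕ
odds [] = []
odds (x ∷ []) = x ∷ []
odds (x ∷ y ∷ xs) = x ∷ odds xs

evens : List ℕ → List ℕ
evens [] = []
evens (x ∷ []) = []
evens (x ∷ y ∷ xs) = y ∷ evens xs

-- For sorted I, J: the sorted multiset union a₁ ≤ b₁ ≤ a₂ ≤ b₂ ≤ ⋯;
-- sort₁ = {a₁,…,a_k}, sort₂ = {b₁,…,b_k}.
sort₁ sort₂ : List ℕ → List ℕ → List ℕ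
sort₁ I J = odds (merge _≤?_ I J)
sort₂ I J = evens (merge _≤?_ I J)

{-# OPTIONS --safe #-}
-- Write N_B(n) = |{x ∈ B | x < n}|.  A strictly increasing B ⊆ [1, r+c] is a basis of the rook
-- matroid iff it has c elements and, for every row i,
--   N_B(r + λᵢ + 1) ≤ λᵢ + N_B(i)   and   μᵢ + N_B(i + 1) ≤ N_B(r + μᵢ + 1).
-- Necessity: the rows in B are the occupied rows and the columns in B the free ones; a rook in a
-- row ≥ i stands in a column ≤ r + λᵢ, and a rook in a column ≤ r + μᵢ stands in a row > i.
-- Sufficiency: pairing the elements of B in increasing order with the columns outside B in
-- decreasing order gives a non-nesting placement, and the inequalities put its cells in the shape.
-- The counting functions of sort₁ I J and sort₂ I J are ⌈(N_I + N_J)/2⌉ and ⌊(N_I + N_J)/2⌋.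
-- Every condition above compares N at two points up to a constant offset, so it survives adding
-- the instances for I and J and rounding half the sum; so does N(x + 1) ≤ N(x) + 1, which for a
-- sorted list means strictly increasing.
module Submission where

open import Defs
open import Data.Empty using (⊥-elim)
open import Data.Fin using (Fin; toℕ; fromℕ<)
open import Data.Fin.Properties using (toℕ<n; toℕ-fromℕ<)
open import Data.List using (List; []; _∷_; _++_; length; merge; zip)
open import Data.List.Membership.Propositional using (_∈_; _∉_; find; lose)
open import Data.List.Relation.Binary.Permutation.Propositional
  using (_↭_; prep; swap; ↭-sym) renaming (refl to ↭-refl; trans to ↭-trans)
open import Data.List.Relation.Binary.Permutation.Propositional.Properties using (merge-↭; All-resp-↭)
open import Data.List.Relation.Unary.All as All using (All; []; _∷_)
import Data.List.Relation.Unary.All.Properties as All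
open import Data.List.Relation.Unary.AllPairs as AllPairs using (AllPairs; []; _∷_)
open import Data.List.Relation.Unary.Any using (Any; here; there; any?)
import Data.List.Relation.Unary.Linked.Properties as Linked
open import Data.List.Relation.Unary.Sorted.TotalOrder.Properties using (merge⁺)
open import Data.Nat using (ℕ; zero; suc; _+_; _≤_; _<_; _>_; _≤?_; _<?_; _≟_; z≤n; s≤s; ⌊_/2⌋; ⌈_/2⌉)
open import Data.Nat.Properties
open import Algebra.Properties.CommutativeSemigroup +-commutativeSemigroup
  using (interchange; x∙yz≈y∙xz; x∙yz≈yx∙z; xy∙z≈zx∙y)
open import Data.List.Membership.DecPropositional _≟_ using (_∈?_)
open import Data.Product using (∃; _×_; _,_; proj₁; proj₂)
open import Data.Sum using (inj₁; inj₂)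
open import Function using (_∘_)
open import Function.Bundles using (_⇔_; Equivalence; mk⇔)
open import Level using (0ℓ)
open import Relation.Nullary using (¬_; Dec; yes; no)
open import Relation.Unary using (Pred; Decidable)
open import Relation.Unary.Properties using (_∩?_; ∁?)
open import Relation.Binary.PropositionalEquality
  using (_≡_; _≢_; refl; sym; trans; cong; cong₂; subst; subst₂; module ≡-Reasoning)

indicator : ∀ {a} {A : Set a} → Dec A → ℕ
indicator (yes _) = 1
indicator (no _)  = 0

below above : ℕ → List ℕ → ℕ
below n []      = 0
below n (x ∷ L) = indicator (x <? n) + below n L
above n []      = 0
above n (x ∷ L) = indicator (n <? x) + above n L

below-none : ∀ {n} L → All (n ≤_) L → below n L ≡ 0
below-none [] [] = refl
below-none {n} (x ∷ L) (n≤x ∷ n≤L) with x <? n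
... | yes x<n = ⊥-elim (≤⇒≯ n≤x x<n)
... | no _    = below-none L n≤L

above-none : ∀ {n} L → All (_≤ n) L → above n L ≡ 0
above-none [] [] = refl
above-none {n} (x ∷ L) (x≤n ∷ L≤n) with n <? x
... | yes n<x = ⊥-elim (≤⇒≯ x≤n n<x)
... | no _    = above-none L L≤n

above-all : ∀ {n} L → All (n <_) L → above n L ≡ length L
above-all [] [] = refl
above-all {n} (x ∷ L) (n<x ∷ n<L) with n <? x
... | yes _   = cong suc (above-all L n<L)
... | no n≮x  = ⊥-elim (n≮x n<x)

below≤length : ∀ n L → below n L ≤ length L
below≤length n [] = z≤n
below≤length n (x ∷ L) with x <? n
... | yes _ = s≤s (below≤length n L)
... | no _  = m≤n⇒m≤1+n (below≤length n L)

below-mono : ∀ {m n} L → m ≤ n → below m L ≤ below n L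
below-mono [] _ = z≤n
below-mono {m} {n} (x ∷ L) m≤n with x <? m | x <? n
... | yes _   | yes _   = s≤s (below-mono L m≤n)
... | yes x<m | no x≮n  = ⊥-elim (x≮n (<-≤-trans x<m m≤n))
... | no _    | yes _   = m≤n⇒m≤1+n (below-mono L m≤n)
... | no _    | no _    = below-mono L m≤n

above-anti : ∀ {m n} L → m ≤ n → above n L ≤ above m L
above-anti [] _ = z≤n
above-anti {m} {n} (x ∷ L) m≤n with m <? x | n <? x
... | yes _   | yes _   = s≤s (above-anti L m≤n)
... | yes _   | no _    = m≤n⇒m≤1+n (above-anti L m≤n)
... | no m≮x  | yes n<x = ⊥-elim (m≮x (≤-<-trans m≤n n<x))
... | no _    | no _    = above-anti L m≤n

above-∈ : ∀ {n y} L → y ∈ L → n < y → above y L < above n L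
above-∈ {n} (x ∷ L) (here refl) n<x with n <? x | x <? x
... | yes _   | no _    = s≤s (above-anti L (<⇒≤ n<x))
... | no n≮x  | _       = ⊥-elim (n≮x n<x)
... | _       | yes x<x = ⊥-elim (<-irrefl refl x<x)
above-∈ {n} {y} (x ∷ L) (there y∈L) n<y with n <? x | y <? x
... | yes _   | yes _   = s≤s (above-∈ L y∈L n<y)
... | yes _   | no _    = m≤n⇒m≤1+n (above-∈ L y∈L n<y)
... | no n≮x  | yes y<x = ⊥-elim (n≮x (<-trans n<y y<x))
... | no _    | no _    = above-∈ L y∈L n<y

below-suc-∉ : ∀ {n} L → n ∉ L → below (suc n) L ≡ below n L
below-suc-∉ [] _ = refl
below-suc-∉ {n} (x ∷ L) n∉ with x <? suc n | x <? n
... | yes _     | yes _   = cong suc (below-suc-∉ L (n∉ ∘ there))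
... | yes x<1+n | no x≮n  = ⊥-elim (n∉ (here (sym (≤-antisym (≤-pred x<1+n) (≮⇒≥ x≮n)))))
... | no x≮1+n  | yes x<n = ⊥-elim (x≮1+n (m≤n⇒m≤1+n x<n))
... | no _      | no _    = below-suc-∉ L (n∉ ∘ there)

below-suc-∈ : ∀ {n} L → AllPairs _<_ L → n ∈ L → below (suc n) L ≡ suc (below n L)
below-suc-∈ {n} (x ∷ L) (x<L ∷ _) (here refl) with x <? suc x | x <? x
... | _      | yes x<x = ⊥-elim (<-irrefl refl x<x)
... | no x≮x | _       = ⊥-elim (x≮x ≤-refl)
... | yes _  | no _    = cong suc (trans (below-none L x<L) (sym (below-none L (All.map <⇒≤ x<L))))
below-suc-∈ {n} (x ∷ L) (x<L ∷ L↑) (there n∈L) with x <? suc n | x <? n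
... | yes _     | yes _   = cong suc (below-suc-∈ L L↑ n∈L)
... | _         | no x≮n  = ⊥-elim (x≮n (All.lookup x<L n∈L))
... | no x≮1+n  | yes x<n = ⊥-elim (x≮1+n (m≤n⇒m≤1+n x<n))

below-↭ : ∀ {n xs ys} → xs ↭ ys → below n xs ≡ below n ys
below-↭ ↭-refl = refl
below-↭ {n} (prep x p) = cong (indicator (x <? n) +_) (below-↭ p)
below-↭ {n} (swap x y p) =
  trans (cong (λ m → indicator (x <? n) + (indicator (y <? n) + m)) (below-↭ p))
        (x∙yz≈y∙xz (indicator (x <? n)) (indicator (y <? n)) _)
below-↭ (↭-trans p q) = trans (below-↭ p) (below-↭ q)

below-++ : ∀ n xs ys → below n (xs ++ ys) ≡ below n xs + below n ys
below-++ n [] ys = refl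
below-++ n (x ∷ xs) ys = trans (cong (indicator (x <? n) +_) (below-++ n xs ys)) (sym (+-assoc (indicator (x <? n)) _ _))

below-merge : ∀ n I J → below n (merge _≤?_ I J) ≡ below n I + below n J
below-merge n I J = trans (below-↭ (merge-↭ _≤?_ I J)) (below-++ n I J)

All-merge : ∀ {P : Pred ℕ 0ℓ} {I J} → All P I → All P J → All P (merge _≤?_ I J)
All-merge {I = I} {J} pI pJ = All-resp-↭ (↭-sym (merge-↭ _≤?_ I J)) (All.++⁺ pI pJ)

merge-sorted : ∀ {I J} → AllPairs _≤_ I → AllPairs _≤_ J → AllPairs _≤_ (merge _≤?_ I J)
merge-sorted I≤ J≤ = Linked.Linked⇒AllPairs ≤-trans
  (merge⁺ ≤-decTotalOrder (Linked.AllPairs⇒Linked I≤) (Linked.AllPairs⇒Linked J≤))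

below-pos : ∀ {n y} L → y ∈ L → y < n → 0 < below n L
below-pos {n} (x ∷ L) (here refl) x<n with x <? n
... | yes _   = s≤s z≤n
... | no x≮n  = ⊥-elim (x≮n x<n)
below-pos {n} (x ∷ L) (there y∈L) y<n = ≤-trans (below-pos L y∈L y<n) (m≤n+m _ (indicator (x <? n)))

AtMostOnce : List ℕ → Set
AtMostOnce L = ∀ x → below (suc x) L ≤ suc (below x L)

increasing⇒atMostOnce : ∀ {L} → AllPairs _<_ L → AtMostOnce L
increasing⇒atMostOnce {L} L↑ x with x ∈? L
... | yes x∈L = ≤-reflexive (below-suc-∈ L L↑ x∈L)
... | no x∉L  = ≤-trans (≤-reflexive (below-suc-∉ L x∉L)) (n≤1+n _)

sorted∧atMostOnce⇒increasing : ∀ L → AllPairs _≤_ L → AtMostOnce L → AllPairs _<_ L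
sorted∧atMostOnce⇒increasing [] _ _ = []
sorted∧atMostOnce⇒increasing (a ∷ L) (a≤L ∷ L≤) once =
  All.tabulate head< ∷ sorted∧atMostOnce⇒increasing L L≤ tail-once
  where
  nothing≤a : below (suc a) L ≡ 0
  nothing≤a with a <? suc a | a <? a | once a
  ... | _        | yes a<a | _     = ⊥-elim (<-irrefl refl a<a)
  ... | no a≮1+a | _       | _     = ⊥-elim (a≮1+a ≤-refl)
  ... | yes _    | no _    | s≤s h = n≤0⇒n≡0 (≤-trans h (≤-reflexive (below-none L a≤L)))
  head< : ∀ {y} → y ∈ L → a < y
  head< {y} y∈L with y <? suc a
  ... | yes y≤a = ⊥-elim (<-irrefl (sym nothing≤a) (below-pos L y∈L y≤a))
  ... | no y≰a  = ≮⇒≥ y≰a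
  tail-once : AtMostOnce L
  tail-once x with a <? suc x | a <? x | once x
  ... | yes _    | yes _   | h = ≤-pred h
  ... | yes _    | no _    | h = ≤-trans (n≤1+n _) h
  ... | no a≮1+x | yes a<x | _ = ⊥-elim (a≮1+x (m≤n⇒m≤1+n a<x))
  ... | no _     | no _    | h = h

⌊k+k+m/2⌋≡k+⌊m/2⌋ : ∀ k m → ⌊ k + k + m /2⌋ ≡ k + ⌊ m /2⌋
⌊k+k+m/2⌋≡k+⌊m/2⌋ zero    m = refl
⌊k+k+m/2⌋≡k+⌊m/2⌋ (suc k) m =
  trans (cong (λ n → ⌊ suc n + m /2⌋) (+-suc k k)) (cong suc (⌊k+k+m/2⌋≡k+⌊m/2⌋ k m))

⌈k+k+m/2⌉≡k+⌈m/2⌉ : ∀ k m → ⌈ k + k + m /2⌉ ≡ k + ⌈ m /2⌉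
⌈k+k+m/2⌉≡k+⌈m/2⌉ k m = trans (cong ⌊_/2⌋ (sym (+-suc (k + k) m))) (⌊k+k+m/2⌋≡k+⌊m/2⌋ k (suc m))

odds-All : ∀ {P : Pred ℕ 0ℓ} {L} → All P L → All P (odds L)
odds-All []           = []
odds-All (p ∷ [])     = p ∷ []
odds-All (p ∷ _ ∷ ps) = p ∷ odds-All ps

evens-All : ∀ {P : Pred ℕ 0ℓ} {L} → All P L → All P (evens L)
evens-All []           = []
evens-All (_ ∷ [])     = []
evens-All (_ ∷ p ∷ ps) = p ∷ evens-All ps

odds-AllPairs : ∀ {R : ℕ → ℕ → Set} {L} → AllPairs R L → AllPairs R (odds L)
odds-AllPairs []                     = []
odds-AllPairs (_ ∷ [])               = [] ∷ []
odds-AllPairs ((_ ∷ xRL) ∷ (_ ∷ ps)) = odds-All xRL ∷ odds-AllPairs ps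

evens-AllPairs : ∀ {R : ℕ → ℕ → Set} {L} → AllPairs R L → AllPairs R (evens L)
evens-AllPairs []               = []
evens-AllPairs (_ ∷ [])         = []
evens-AllPairs (_ ∷ (yRL ∷ ps)) = evens-All yRL ∷ evens-AllPairs ps

below-odds : ∀ n {L} → AllPairs _≤_ L → below n (odds L) ≡ ⌈ below n L /2⌉
below-odds n {[]} _ = refl
below-odds n {a ∷ []} _ with a <? n
... | yes _ = refl
... | no _  = refl
below-odds n {a ∷ b ∷ L} ((a≤b ∷ _) ∷ (b≤L ∷ L≤)) with a <? n | b <? n
... | yes _   | yes _   = cong suc (below-odds n L≤)
... | no a≮n  | yes b<n = ⊥-elim (a≮n (≤-<-trans a≤b b<n))
... | yes _   | no b≮n
  rewrite below-odds n L≤ | below-none L (All.map (≤-trans (≮⇒≥ b≮n)) b≤L) = refl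
... | no _    | no b≮n
  rewrite below-odds n L≤ | below-none L (All.map (≤-trans (≮⇒≥ b≮n)) b≤L) = refl

below-evens : ∀ n {L} → AllPairs _≤_ L → below n (evens L) ≡ ⌊ below n L /2⌋
below-evens n {[]} _ = refl
below-evens n {a ∷ []} _ with a <? n
... | yes _ = refl
... | no _  = refl
below-evens n {a ∷ b ∷ L} ((a≤b ∷ _) ∷ (b≤L ∷ L≤)) with a <? n | b <? n
... | yes _   | yes _   = cong suc (below-evens n L≤)
... | no a≮n  | yes b<n = ⊥-elim (a≮n (≤-<-trans a≤b b<n))
... | yes _   | no b≮n
  rewrite below-evens n L≤ | below-none L (All.map (≤-trans (≮⇒≥ b≮n)) b≤L) = refl
... | no _    | no b≮n
  rewrite below-evens n L≤ | below-none L (All.map (≤-trans (≮⇒≥ b≮n)) b≤L) = refl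

-- Row i of λ/μ is indexed by k with i = toℕ k + 1, and below (suc n) B = |B ∩ [1, n]|.
record Admissible {r c : ℕ} (S : SkewShape r c) (B : List ℕ) : Set where
  field
    increasing : AllPairs _<_ B
    bounded    : All (λ x → 1 ≤ x × x ≤ r + c) B
    size       : below (suc (r + c)) B ≡ c
    lam-bound  : ∀ k → below (suc (r + lam S k)) B ≤ lam S k + below (suc (toℕ k)) B
    mu-bound   : ∀ k → mu S k + below (suc (suc (toℕ k))) B ≤ below (suc (r + mu S k)) B

module RoundedAverage
  (select : List ℕ → List ℕ) (round : ℕ → ℕ)
  (round-mono : ∀ {m n} → m ≤ n → round m ≤ round n)
  (round-shift : ∀ k m → round (k + k + m) ≡ k + round m)
  (round-double : ∀ k → round (k + k) ≡ k)
  (select-All : ∀ {P : Pred ℕ 0ℓ} {L} → All P L → All P (select L))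
  (select-sorted : ∀ {L} → AllPairs _≤_ L → AllPairs _≤_ (select L))
  (below-select : ∀ n {L} → AllPairs _≤_ L → below n (select L) ≡ round (below n L))
  where

  round-average-upper : ∀ k {a₁ a₂ b₁ b₂} → a₁ ≤ k + b₁ → a₂ ≤ k + b₂ →
                        round (a₁ + a₂) ≤ k + round (b₁ + b₂)
  round-average-upper k {a₁} {a₂} {b₁} {b₂} h₁ h₂ = begin
    round (a₁ + a₂)             ≤⟨ round-mono (+-mono-≤ h₁ h₂) ⟩
    round ((k + b₁) + (k + b₂)) ≡⟨ cong round (interchange k b₁ k b₂) ⟩
    round ((k + k) + (b₁ + b₂)) ≡⟨ round-shift k (b₁ + b₂) ⟩
    k + round (b₁ + b₂)         ∎
    where open ≤-Reasoning

  round-average-lower : ∀ k {a₁ a₂ b₁ b₂} → k + a₁ ≤ b₁ → k + a₂ ≤ b₂ →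
                        k + round (a₁ + a₂) ≤ round (b₁ + b₂)
  round-average-lower k {a₁} {a₂} {b₁} {b₂} h₁ h₂ = begin
    k + round (a₁ + a₂)         ≡⟨ round-shift k (a₁ + a₂) ⟨
    round ((k + k) + (a₁ + a₂)) ≡⟨ cong round (interchange k k a₁ a₂) ⟩
    round ((k + a₁) + (k + a₂)) ≤⟨ round-mono (+-mono-≤ h₁ h₂) ⟩
    round (b₁ + b₂)             ∎
    where open ≤-Reasoning

  select-merge-admissible : ∀ {r c} (S : SkewShape r c) {I J} →
    Admissible S I → Admissible S J → Admissible S (select (merge _≤?_ I J))
  select-merge-admissible {r} {c} S {I} {J} adm-I adm-J = record
    { increasing = sorted∧atMostOnce⇒increasing (select M) (select-sorted M-sorted) once
    ; bounded    = select-All (All-merge I.bounded J.bounded)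
    ; size       = trans (below-M _) (trans (cong round (cong₂ _+_ I.size J.size)) (round-double c))
    ; lam-bound  = λ k → subst₂ (λ u v → u ≤ lam S k + v) (sym (below-M _)) (sym (below-M _))
                           (round-average-upper (lam S k) (I.lam-bound k) (J.lam-bound k))
    ; mu-bound   = λ k → subst₂ (λ u v → mu S k + u ≤ v) (sym (below-M _)) (sym (below-M _))
                           (round-average-lower (mu S k) (I.mu-bound k) (J.mu-bound k))
    }
    where
    module I = Admissible adm-I
    module J = Admissible adm-J
    M : List ℕ
    M = merge _≤?_ I J
    M-sorted : AllPairs _≤_ M
    M-sorted = merge-sorted (AllPairs.map <⇒≤ I.increasing) (AllPairs.map <⇒≤ J.increasing)
    below-M : ∀ n → below n (select M) ≡ round (below n I + below n J)
    below-M n = trans (below-select n M-sorted) (cong round (below-merge n I J))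
    once : AtMostOnce (select M)
    once x = subst₂ (λ u v → u ≤ suc v) (sym (below-M _)) (sym (below-M _))
               (round-average-upper 1 (increasing⇒atMostOnce I.increasing x)
                                      (increasing⇒atMostOnce J.increasing x))

sort₁-admissible : ∀ {r c} (S : SkewShape r c) {I J} →
  Admissible S I → Admissible S J → Admissible S (sort₁ I J)
sort₁-admissible = RoundedAverage.select-merge-admissible odds ⌈_/2⌉
  ⌈n/2⌉-mono ⌈k+k+m/2⌉≡k+⌈m/2⌉ (sym ∘ n≡⌈n+n/2⌉) odds-All odds-AllPairs below-odds

sort₂-admissible : ∀ {r c} (S : SkewShape r c) {I J} →
  Admissible S I → Admissible S J → Admissible S (sort₂ I J)
sort₂-admissible = RoundedAverage.select-merge-admissible evens ⌊_/2⌋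
  ⌊n/2⌋-mono ⌊k+k+m/2⌋≡k+⌊m/2⌋ (sym ∘ n≡⌊n+n/2⌋) evens-All evens-AllPairs below-evens

count : ∀ {P : Pred ℕ 0ℓ} → Decidable P → ℕ → ℕ
count P? zero    = 0
count P? (suc n) = indicator (P? n) + count P? n

count-mono : ∀ {P Q : Pred ℕ 0ℓ} (P? : Decidable P) (Q? : Decidable Q) n →
             (∀ {x} → x < n → P x → Q x) → count P? n ≤ count Q? n
count-mono P? Q? zero    _   = z≤n
count-mono P? Q? (suc n) P⇒Q with P? n | Q? n
... | yes _  | yes _  = s≤s (count-mono P? Q? n (P⇒Q ∘ m≤n⇒m≤1+n))
... | yes Pn | no ¬Qn = ⊥-elim (¬Qn (P⇒Q ≤-refl Pn))
... | no _   | yes _  = m≤n⇒m≤1+n (count-mono P? Q? n (P⇒Q ∘ m≤n⇒m≤1+n))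
... | no _   | no _   = count-mono P? Q? n (P⇒Q ∘ m≤n⇒m≤1+n)

count-cong : ∀ {P Q : Pred ℕ 0ℓ} (P? : Decidable P) (Q? : Decidable Q) n →
             (∀ {x} → x < n → P x → Q x) → (∀ {x} → x < n → Q x → P x) →
             count P? n ≡ count Q? n
count-cong P? Q? n P⇒Q Q⇒P = ≤-antisym (count-mono P? Q? n P⇒Q) (count-mono Q? P? n Q⇒P)

count-none : ∀ {P : Pred ℕ 0ℓ} (P? : Decidable P) n → (∀ {x} → x < n → ¬ P x) → count P? n ≡ 0
count-none P? zero    _  = refl
count-none P? (suc n) ¬P with P? n
... | yes Pn = ⊥-elim (¬P ≤-refl Pn)
... | no _   = count-none P? n (¬P ∘ m≤n⇒m≤1+n)

count-split : ∀ {P Q : Pred ℕ 0ℓ} (P? : Decidable P) (Q? : Decidable Q) n →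
              count P? n ≡ count (P? ∩? Q?) n + count (P? ∩? ∁? Q?) n
count-split P? Q? zero = refl
count-split P? Q? (suc n) with P? n | Q? n
... | yes _ | yes _ = cong suc (count-split P? Q? n)
... | yes _ | no _  = trans (cong suc (count-split P? Q? n)) (sym (+-suc _ _))
... | no _  | yes _ = count-split P? Q? n
... | no _  | no _  = count-split P? Q? n

count-prefix : ∀ {P : Pred ℕ 0ℓ} (P? : Decidable P) {i n} → i ≤ n →
               count (P? ∩? (_<? i)) n ≡ count P? i
count-prefix P? {i} i≤n with m≤n⇒∃[o]m+o≡n i≤n
... | o , refl = go o
  where
  go : ∀ o → count (P? ∩? (_<? i)) (i + o) ≡ count P? i
  go zero rewrite +-identityʳ i = count-cong _ P? i (λ _ → proj₁) (λ x<i Px → Px , x<i)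
  go (suc o) rewrite +-suc i o with P? (i + o) | i + o <? i
  ... | _     | yes i+o<i = ⊥-elim (<-irrefl refl (≤-<-trans (m≤m+n i o) i+o<i))
  ... | yes _ | no _      = go o
  ... | no _  | no _      = go o

count-remove : ∀ {Q : Pred ℕ 0ℓ} (Q? : Decidable Q) {z m} → Q z → z < m →
               count Q? m ≡ suc (count (Q? ∩? ∁? (_≟ z)) m)
count-remove Q? {z} {suc m} Qz z<1+m with m ≟ z | Q? m
... | yes refl | yes _ = cong suc (count-cong Q? _ m (λ x<m Qx → Qx , λ x≡m → <-irrefl x≡m x<m) (λ _ → proj₁))
... | yes refl | no ¬Qz = ⊥-elim (¬Qz Qz)
... | no m≢z   | yes _ = cong suc (count-remove Q? Qz (≤∧≢⇒< (≤-pred z<1+m) (m≢z ∘ sym)))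
... | no m≢z   | no _  = count-remove Q? Qz (≤∧≢⇒< (≤-pred z<1+m) (m≢z ∘ sym))

count-injection : ∀ {P Q : Pred ℕ 0ℓ} (P? : Decidable P) (Q? : Decidable Q) (R : ℕ → ℕ → Set) {n m} →
  (∀ {x} → x < n → P x → ∃ λ y → Q y × y < m × R x y) →
  (∀ {x x′ y} → R x y → R x′ y → x ≡ x′) →
  count P? n ≤ count Q? m
count-injection P? Q? R {zero}  f f-inj = z≤n
count-injection {P} {Q} P? Q? R {suc n} {m} f f-inj with P? n
... | no _   = count-injection P? Q? R (f ∘ m≤n⇒m≤1+n) f-inj
... | yes Pn with f ≤-refl Pn
...   | y₀ , Qy₀ , y₀<m , Rny₀ =
  ≤-trans (s≤s (count-injection P? (Q? ∩? ∁? (_≟ y₀)) R f′ f-inj))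
          (≤-reflexive (sym (count-remove Q? Qy₀ y₀<m)))
  where
  f′ : ∀ {x} → x < n → P x → ∃ λ y → (Q y × y ≢ y₀) × y < m × R x y
  f′ x<n Px with f (m≤n⇒m≤1+n x<n) Px
  ... | y , Qy , y<m , Rxy = y , (Qy , λ { refl → <-irrefl (f-inj Rxy Rny₀) x<n }) , y<m , Rxy

count-∈≡below : ∀ {B} → AllPairs _<_ B → ∀ n → count (_∈? B) n ≡ below n B
count-∈≡below {B} _  zero    = sym (below-none B (All.tabulate (λ _ → z≤n)))
count-∈≡below {B} B↑ (suc n) with n ∈? B
... | yes n∈B = trans (cong suc (count-∈≡below B↑ n)) (sym (below-suc-∈ B B↑ n∈B))
... | no n∉B  = trans (count-∈≡below B↑ n) (sym (below-suc-∉ B n∉B))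

module RookCounting {r c : ℕ} (S : SkewShape r c) {B : List ℕ} {ρ : List Cell}
  (B↑ : AllPairs _<_ B) (placement : NonNestingRookPlacement S ρ)
  (basis : ∀ x → (x ∈ B) ⇔ InRC r c ρ x) where
  open NonNestingRookPlacement placement

  RowOccupied ColumnOccupied : Pred ℕ 0ℓ
  RowOccupied x    = Any ((_≡ x) ∘ proj₁) ρ
  ColumnOccupied y = Any ((_≡ y) ∘ proj₂) ρ

  row? : Decidable RowOccupied
  row? x = any? ((_≟ x) ∘ proj₁) ρ

  column? : Decidable ColumnOccupied
  column? y = any? ((_≟ y) ∘ proj₂) ρ

  B? : Decidable (_∈ B)
  B? = _∈? B

  Rook : ℕ → ℕ → Set
  Rook x y = (x , y) ∈ ρ

  rook-row-bounds : ∀ {p} → p ∈ ρ → 1 ≤ proj₁ p × proj₁ p ≤ r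
  rook-row-bounds p∈ρ with inShape p∈ρ
  ... | k , refl , _ , _ = s≤s z≤n , toℕ<n k

  rook-column-bounds : ∀ {p} → p ∈ ρ → r < proj₂ p × proj₂ p ≤ r + c
  rook-column-bounds p∈ρ with inShape p∈ρ
  ... | k , _ , μ< , ≤λ = ≤-<-trans (m≤m+n r _) μ< , ≤-trans ≤λ (+-monoʳ-≤ r (lam-≤c S k))

  row-∈B⇒occupied : ∀ {x} → x ≤ r → x ∈ B → RowOccupied x
  row-∈B⇒occupied x≤r x∈B with Equivalence.to (basis _) x∈B
  ... | inj₁ (p , p∈ρ , e) = lose p∈ρ e
  ... | inj₂ (r<x , _ , _) = ⊥-elim (≤⇒≯ x≤r r<x)

  row-occupied⇒∈B : ∀ {x} → RowOccupied x → x ∈ B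
  row-occupied⇒∈B occ with find occ
  ... | p , p∈ρ , e = Equivalence.from (basis _) (inj₁ (p , p∈ρ , e))

  column-∈B⇒free : ∀ {y} → r < y → y ∈ B → ¬ ColumnOccupied y
  column-∈B⇒free r<y y∈B occ with Equivalence.to (basis _) y∈B | find occ
  ... | inj₁ (p , p∈ρ , refl) | _           = ≤⇒≯ (proj₂ (rook-row-bounds p∈ρ)) r<y
  ... | inj₂ (_ , _ , free)   | p , p∈ρ , e = free p p∈ρ e

  column-free⇒∈B : ∀ {y} → r < y → y ≤ r + c → ¬ ColumnOccupied y → y ∈ B
  column-free⇒∈B r<y y≤r+c free =
    Equivalence.from (basis _) (inj₂ (r<y , y≤r+c , λ p p∈ρ e → free (lose p∈ρ e)))

  bounded : All (λ x → 1 ≤ x × x ≤ r + c) B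
  bounded = All.tabulate (bounds ∘ Equivalence.to (basis _))
    where
    bounds : ∀ {x} → InRC r c ρ x → 1 ≤ x × x ≤ r + c
    bounds (inj₁ (p , p∈ρ , refl))  = proj₁ (rook-row-bounds p∈ρ) , ≤-trans (proj₂ (rook-row-bounds p∈ρ)) (m≤m+n r c)
    bounds (inj₂ (r<x , x≤r+c , _)) = ≤-trans (s≤s z≤n) r<x , x≤r+c

  rooks : ℕ
  rooks = count row? (suc r)

  count-B-rows : ∀ {i} → i ≤ suc r → count B? i ≡ count row? i
  count-B-rows i≤1+r = count-cong B? row? _
    (λ x<i → row-∈B⇒occupied (≤-pred (≤-trans x<i i≤1+r))) (λ _ → row-occupied⇒∈B)

  column-balance : ∀ j → j ≤ c → count B? (suc (r + j)) + count column? (suc (r + j)) ≡ rooks + j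
  column-balance zero _ rewrite +-identityʳ r =
    cong₂ _+_ (count-B-rows ≤-refl) (count-none column? (suc r) no-rook)
    where
    no-rook : ∀ {y} → y < suc r → ¬ ColumnOccupied y
    no-rook y<1+r occ with find occ
    ... | p , p∈ρ , refl = ≤⇒≯ (≤-pred y<1+r) (proj₁ (rook-column-bounds p∈ρ))
  column-balance (suc j) 1+j≤c rewrite +-suc r j with B? (suc (r + j)) | column? (suc (r + j))
  ... | yes y∈B | yes occ = ⊥-elim (column-∈B⇒free (s≤s (m≤m+n r j)) y∈B occ)
  ... | yes _   | no _    =
    trans (cong suc (column-balance j (≤-trans (n≤1+n j) 1+j≤c))) (sym (+-suc rooks j))
  ... | no _    | yes _   =
    trans (+-suc _ _) (trans (cong suc (column-balance j (≤-trans (n≤1+n j) 1+j≤c))) (sym (+-suc rooks j)))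
  ... | no y∉B  | no free =
    ⊥-elim (y∉B (column-free⇒∈B (s≤s (m≤m+n r j)) (subst (_≤ r + c) (+-suc r j) (+-monoʳ-≤ r 1+j≤c)) free))

  rooks-split : ∀ {i} → i ≤ suc r → rooks ≡ count row? i + count (row? ∩? ∁? (_<? i)) (suc r)
  rooks-split {i} i≤1+r = trans (count-split row? (_<? i) (suc r)) (cong (_+ count (row? ∩? ∁? (_<? i)) (suc r)) (count-prefix row? i≤1+r))

  lam-bound : ∀ k → count B? (suc (r + lam S k)) ≤ lam S k + count B? (suc (toℕ k))
  lam-bound k = +-cancelʳ-≤ columns _ _ (begin
    count B? (suc (r + λₖ)) + columns     ≡⟨ column-balance λₖ (lam-≤c S k) ⟩
    rooks + λₖ                            ≡⟨ cong (_+ λₖ) (rooks-split i≤1+r) ⟩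
    count row? i + later-rows + λₖ        ≤⟨ +-monoˡ-≤ λₖ (+-monoʳ-≤ (count row? i) later-rows≤columns) ⟩
    count row? i + columns + λₖ           ≡⟨ xy∙z≈zx∙y (count row? i) columns λₖ ⟩
    λₖ + count row? i + columns           ≡⟨ cong (λ m → λₖ + m + columns) (count-B-rows i≤1+r) ⟨
    λₖ + count B? i + columns             ∎)
    where
    open ≤-Reasoning
    λₖ : ℕ
    λₖ = lam S k
    i : ℕ
    i = suc (toℕ k)
    i≤1+r : i ≤ suc r
    i≤1+r = s≤s (<⇒≤ (toℕ<n k))
    columns : ℕ
    columns = count column? (suc (r + λₖ))
    later-rows : ℕ
    later-rows = count (row? ∩? ∁? (_<? i)) (suc r)
    -- λ is weakly decreasing, so a rook in a row ≥ i lies in a column ≤ r + λₖ.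
    rook-column : ∀ {x} → x < suc r → RowOccupied x × ¬ x < i →
                  ∃ λ y → ColumnOccupied y × y < suc (r + λₖ) × Rook x y
    rook-column _ (occ , x≮i) with find occ
    ... | (x , y) , p∈ρ , refl with inShape p∈ρ
    ...   | k′ , refl , _ , y≤ =
      y , lose p∈ρ refl , s≤s (≤-trans y≤ (+-monoʳ-≤ r (lam-decr S k k′ (≤-pred (≮⇒≥ x≮i))))) , p∈ρ
    later-rows≤columns : later-rows ≤ columns
    later-rows≤columns = count-injection _ column? Rook rook-column (λ p q → cong proj₁ (colDistinct p q refl))

  mu-bound : ∀ k → mu S k + count B? (suc (suc (toℕ k))) ≤ count B? (suc (r + mu S k))
  mu-bound k = +-cancelʳ-≤ columns _ _ (begin
    μₖ + count B? i + columns             ≡⟨ cong (λ m → μₖ + m + columns) (count-B-rows i≤1+r) ⟩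
    μₖ + count row? i + columns           ≡⟨ +-assoc μₖ (count row? i) columns ⟩
    μₖ + (count row? i + columns)         ≤⟨ +-monoʳ-≤ μₖ (+-monoʳ-≤ (count row? i) columns≤later-rows) ⟩
    μₖ + (count row? i + later-rows)      ≡⟨ cong (μₖ +_) (rooks-split i≤1+r) ⟨
    μₖ + rooks                            ≡⟨ +-comm μₖ rooks ⟩
    rooks + μₖ                            ≡⟨ column-balance μₖ (≤-trans (<⇒≤ (row-nonempty S k)) (lam-≤c S k)) ⟨
    count B? (suc (r + μₖ)) + columns     ∎)
    where
    open ≤-Reasoning
    μₖ : ℕ
    μₖ = mu S k
    i : ℕ
    i = suc (suc (toℕ k))
    i≤1+r : i ≤ suc r
    i≤1+r = s≤s (toℕ<n k)
    columns : ℕ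
    columns = count column? (suc (r + μₖ))
    later-rows : ℕ
    later-rows = count (row? ∩? ∁? (_<? i)) (suc r)
    -- μ is weakly decreasing, so a rook in a column ≤ r + μₖ lies in a row ≥ i.
    column-rook : ∀ {y} → y < suc (r + μₖ) → ColumnOccupied y →
                  ∃ λ x → (RowOccupied x × ¬ x < i) × x < suc r × Rook x y
    column-rook y≤ occ with find occ
    ... | (x , y) , p∈ρ , refl with inShape p∈ρ
    ...   | k′ , refl , μ< , _ = suc (toℕ k′) , (lose p∈ρ refl , x≮i) , s≤s (toℕ<n k′) , p∈ρ
      where
      x≮i : ¬ suc (toℕ k′) < i
      x≮i x<i = <-irrefl refl (<-≤-trans (<-≤-trans μ< (≤-pred y≤)) (+-monoʳ-≤ r (mu-decr S k′ k (≤-pred (≤-pred x<i)))))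
    columns≤later-rows : columns ≤ later-rows
    columns≤later-rows = count-injection column? _ (λ y x → Rook x y) column-rook
                           (λ p q → cong proj₂ (rowDistinct p q refl))

  size : count B? (suc (r + c)) ≡ c
  size = +-cancelʳ-≡ columns _ _ (begin
    count B? (suc (r + c)) + columns ≡⟨ column-balance c ≤-refl ⟩
    rooks + c                        ≡⟨ cong (_+ c) rooks≡columns ⟩
    columns + c                      ≡⟨ +-comm columns c ⟩
    c + columns                      ∎)
    where
    open ≡-Reasoning
    columns : ℕ
    columns = count column? (suc (r + c))
    rook-column : ∀ {x} → x < suc r → RowOccupied x → ∃ λ y → ColumnOccupied y × y < suc (r + c) × Rook x y
    rook-column _ occ with find occ
    ... | (x , y) , p∈ρ , refl = y , lose p∈ρ refl , s≤s (proj₂ (rook-column-bounds p∈ρ)) , p∈ρ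
    column-rook : ∀ {y} → y < suc (r + c) → ColumnOccupied y → ∃ λ x → RowOccupied x × x < suc r × Rook x y
    column-rook _ occ with find occ
    ... | (x , y) , p∈ρ , refl = x , lose p∈ρ refl , s≤s (proj₂ (rook-row-bounds p∈ρ)) , p∈ρ
    rooks≡columns : rooks ≡ columns
    rooks≡columns = ≤-antisym
      (count-injection row? column? Rook rook-column (λ p q → cong proj₁ (colDistinct p q refl)))
      (count-injection column? row? (λ y x → Rook x y) column-rook (λ p q → cong proj₂ (rowDistinct p q refl)))

  admissible : Admissible S B
  admissible = record
    { increasing = B↑
    ; bounded    = bounded
    ; size       = trans (sym (below≡ _)) size
    ; lam-bound  = λ k → subst₂ (λ u v → u ≤ lam S k + v) (below≡ _) (below≡ _) (lam-bound k)
    ; mu-bound   = λ k → subst₂ (λ u v → mu S k + u ≤ v) (below≡ _) (below≡ _) (mu-bound k)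
    }
    where
    below≡ : ∀ n → count B? n ≡ below n B
    below≡ = count-∈≡below B↑

basis⇒admissible : ∀ {r c} (S : SkewShape r c) {B} → IsRookBasis S B → Admissible S B
basis⇒admissible S (B↑ , ρ , placement , basis) =
  RookCounting.admissible S (Linked.Linked⇒AllPairs <-trans B↑) placement basis

module _ {X Y : Set} where

  ∈-zip⁻ : ∀ {a : X} {b : Y} {Xs Ys} → (a , b) ∈ zip Xs Ys → a ∈ Xs × b ∈ Ys
  ∈-zip⁻ {Xs = _ ∷ _} {_ ∷ _} (here refl) = here refl , here refl
  ∈-zip⁻ {Xs = _ ∷ _} {_ ∷ _} (there ab∈) = let a∈ , b∈ = ∈-zip⁻ ab∈ in there a∈ , there b∈

  ∈-zip⁺ʳ : ∀ {b : Y} (Xs : List X) {Ys} → length Ys ≤ length Xs → b ∈ Ys → ∃ λ a → (a , b) ∈ zip Xs Ys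
  ∈-zip⁺ʳ (x ∷ _)  (s≤s _)  (here refl) = x , here refl
  ∈-zip⁺ʳ (_ ∷ Xs) (s≤s |Ys|≤|Xs|) (there b∈) = let a , ab∈ = ∈-zip⁺ʳ Xs |Ys|≤|Xs| b∈ in a , there ab∈

∈-zip⁺ˡ : ∀ {Y : Set} {a} Xs (Ys : List Y) → AllPairs _<_ Xs → a ∈ Xs → below a Xs < length Ys → ∃ λ b → (a , b) ∈ zip Xs Ys
∈-zip⁺ˡ (x ∷ Xs) (y ∷ Ys) _ (here refl) _ = y , here refl
∈-zip⁺ˡ {a = a} (x ∷ Xs) (y ∷ Ys) (x<Xs ∷ Xs↑) (there a∈) rank<
  with x <? a
... | yes _   = let b , ab∈ = ∈-zip⁺ˡ Xs Ys Xs↑ a∈ (≤-pred rank<) in b , there ab∈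
... | no x≮a  = ⊥-elim (x≮a (All.lookup x<Xs a∈))

zip-rank : ∀ {a b} Xs Ys → AllPairs _<_ Xs → AllPairs _>_ Ys → (a , b) ∈ zip Xs Ys → below a Xs ≡ above b Ys
zip-rank (x ∷ Xs) (y ∷ Ys) (x<Xs ∷ _) (y>Ys ∷ _) (here refl) with x <? x | y <? y
... | yes x<x | _       = ⊥-elim (<-irrefl refl x<x)
... | _       | yes y<y = ⊥-elim (<-irrefl refl y<y)
... | no _    | no _    = trans (below-none Xs (All.map <⇒≤ x<Xs)) (sym (above-none Ys (All.map <⇒≤ y>Ys)))
zip-rank {a} {b} (x ∷ Xs) (y ∷ Ys) (x<Xs ∷ Xs↑) (y>Ys ∷ Ys↓) (there ab∈) with x <? a | b <? y
... | yes _   | yes _   = cong suc (zip-rank Xs Ys Xs↑ Ys↓ ab∈)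
... | no x≮a  | _       = ⊥-elim (x≮a (All.lookup x<Xs (proj₁ (∈-zip⁻ ab∈))))
... | _       | no b≮y  = ⊥-elim (b≮y (All.lookup y>Ys (proj₂ (∈-zip⁻ ab∈))))

zip-injectiveˡ : ∀ {p q : ℕ × ℕ} Xs Ys → AllPairs _<_ Xs →
                 p ∈ zip Xs Ys → q ∈ zip Xs Ys → proj₁ p ≡ proj₁ q → p ≡ q
zip-injectiveˡ (x ∷ Xs) (y ∷ Ys) _ (here refl) (here refl) _ = refl
zip-injectiveˡ (x ∷ Xs) (y ∷ Ys) (x<Xs ∷ _) (here refl) (there q∈) e =
  ⊥-elim (<-irrefl e (All.lookup x<Xs (proj₁ (∈-zip⁻ q∈))))
zip-injectiveˡ (x ∷ Xs) (y ∷ Ys) (x<Xs ∷ _) (there p∈) (here refl) e =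
  ⊥-elim (<-irrefl (sym e) (All.lookup x<Xs (proj₁ (∈-zip⁻ p∈))))
zip-injectiveˡ (x ∷ Xs) (y ∷ Ys) (_ ∷ Xs↑) (there p∈) (there q∈) e = zip-injectiveˡ Xs Ys Xs↑ p∈ q∈ e

zip-injectiveʳ : ∀ {p q : ℕ × ℕ} Xs Ys → AllPairs _>_ Ys →
                 p ∈ zip Xs Ys → q ∈ zip Xs Ys → proj₂ p ≡ proj₂ q → p ≡ q
zip-injectiveʳ (x ∷ Xs) (y ∷ Ys) _ (here refl) (here refl) _ = refl
zip-injectiveʳ (x ∷ Xs) (y ∷ Ys) (y>Ys ∷ _) (here refl) (there q∈) e =
  ⊥-elim (<-irrefl (sym e) (All.lookup y>Ys (proj₂ (∈-zip⁻ q∈))))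
zip-injectiveʳ (x ∷ Xs) (y ∷ Ys) (y>Ys ∷ _) (there p∈) (here refl) e =
  ⊥-elim (<-irrefl e (All.lookup y>Ys (proj₂ (∈-zip⁻ p∈))))
zip-injectiveʳ (x ∷ Xs) (y ∷ Ys) (_ ∷ Ys↓) (there p∈) (there q∈) e = zip-injectiveʳ Xs Ys Ys↓ p∈ q∈ e

zip-nonNesting : ∀ {p q : ℕ × ℕ} Xs Ys → AllPairs _<_ Xs → AllPairs _>_ Ys →
                 p ∈ zip Xs Ys → q ∈ zip Xs Ys → ¬ (proj₁ p < proj₁ q × proj₂ p < proj₂ q)
zip-nonNesting (x ∷ Xs) (y ∷ Ys) _ _ (here refl) (here refl) (x<x , _) = <-irrefl refl x<x
zip-nonNesting (x ∷ Xs) (y ∷ Ys) _ (y>Ys ∷ _) (here refl) (there q∈) (_ , y<) =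
  <-asym y< (All.lookup y>Ys (proj₂ (∈-zip⁻ q∈)))
zip-nonNesting (x ∷ Xs) (y ∷ Ys) (x<Xs ∷ _) _ (there p∈) (here refl) (<x , _) =
  <-asym <x (All.lookup x<Xs (proj₁ (∈-zip⁻ p∈)))
zip-nonNesting (x ∷ Xs) (y ∷ Ys) (_ ∷ Xs↑) (_ ∷ Ys↓) (there p∈) (there q∈) =
  zip-nonNesting Xs Ys Xs↑ Ys↓ p∈ q∈

module GreedyPlacement {r c : ℕ} (S : SkewShape r c) {B : List ℕ} (adm : Admissible S B) where
  open Admissible adm

  B? : Decidable (_∈ B)
  B? = _∈? B

  freeColumns : ℕ → List ℕ
  freeColumns zero = []
  freeColumns (suc j) with B? (suc (r + j))
  ... | yes _ = freeColumns j
  ... | no _  = suc (r + j) ∷ freeColumns j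

  FreeColumn : ℕ → Pred ℕ 0ℓ
  FreeColumn j y = r < y × y ≤ r + j × y ∉ B

  FreeColumn-suc : ∀ {j y} → FreeColumn j y → FreeColumn (suc j) y
  FreeColumn-suc (r<y , y≤r+j , y∉B) = r<y , ≤-trans y≤r+j (+-monoʳ-≤ r (n≤1+n _)) , y∉B

  freeColumns-free : ∀ j → All (FreeColumn j) (freeColumns j)
  freeColumns-free zero = []
  freeColumns-free (suc j) with B? (suc (r + j))
  ... | yes _   = All.map FreeColumn-suc (freeColumns-free j)
  ... | no y∉B  = (s≤s (m≤m+n r j) , ≤-reflexive (sym (+-suc r j)) , y∉B)
                  ∷ All.map FreeColumn-suc (freeColumns-free j)

  freeColumns-decreasing : ∀ j → AllPairs _>_ (freeColumns j)
  freeColumns-decreasing zero = []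
  freeColumns-decreasing (suc j) with B? (suc (r + j))
  ... | yes _ = freeColumns-decreasing j
  ... | no _  = All.map (s≤s ∘ proj₁ ∘ proj₂) (freeColumns-free j) ∷ freeColumns-decreasing j

  ∈-freeColumns : ∀ {y} j → r < y → y ≤ r + j → y ∉ B → y ∈ freeColumns j
  ∈-freeColumns {y} zero r<y y≤r+0 _ = ⊥-elim (≤⇒≯ (subst (y ≤_) (+-identityʳ r) y≤r+0) r<y)
  ∈-freeColumns {y} (suc j) r<y y≤ y∉B with B? (suc (r + j)) | y ≟ suc (r + j)
  ... | yes y∈B | yes refl = ⊥-elim (y∉B y∈B)
  ... | no _    | yes refl = here refl
  ... | yes _   | no y≢    = ∈-freeColumns j r<y (≤-pred (≤∧≢⇒< (subst (y ≤_) (+-suc r j) y≤) y≢)) y∉B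
  ... | no _    | no y≢    = there (∈-freeColumns j r<y (≤-pred (≤∧≢⇒< (subst (y ≤_) (+-suc r j) y≤) y≢)) y∉B)

  above-freeColumns : ∀ b j → b ≤ j →
    above (r + b) (freeColumns j) + count B? (suc (r + j)) + b ≡ j + count B? (suc (r + b))
  above-freeColumns b j b≤j with m≤n⇒m<n∨m≡n b≤j
  ... | inj₂ refl rewrite above-none (freeColumns b) (All.map (proj₁ ∘ proj₂) (freeColumns-free b)) = +-comm _ b
  above-freeColumns b (suc j) _ | inj₁ b<1+j rewrite +-suc r j with B? (suc (r + j))
  ... | yes _ = trans (cong (_+ b) (+-suc (above (r + b) (freeColumns j)) _))
                      (cong suc (above-freeColumns b j (≤-pred b<1+j)))
  ... | no _ with r + b <? suc (r + j)
  ...   | yes _     = cong suc (above-freeColumns b j (≤-pred b<1+j))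
  ...   | no r+b≮   = ⊥-elim (r+b≮ (s≤s (+-monoʳ-≤ r (≤-pred b<1+j))))

  Ys : List ℕ
  Ys = freeColumns c

  Ys↓ : AllPairs _>_ Ys
  Ys↓ = freeColumns-decreasing c

  count≡below : ∀ n → count B? n ≡ below n B
  count≡below = count-∈≡below increasing

  above-Ys : ∀ {b} → b ≤ c → above (r + b) Ys + b ≡ below (suc (r + b)) B
  above-Ys {b} b≤c = +-cancelˡ-≡ c _ _ (begin
    c + (above (r + b) Ys + b)         ≡⟨ x∙yz≈yx∙z c (above (r + b) Ys) b ⟩
    above (r + b) Ys + c + b           ≡⟨ cong (λ m → above (r + b) Ys + m + b) (trans (sym size) (sym (count≡below _))) ⟩
    above (r + b) Ys + count B? (suc (r + c)) + b ≡⟨ above-freeColumns b c b≤c ⟩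
    c + count B? (suc (r + b))         ≡⟨ cong (c +_) (count≡below _) ⟩
    c + below (suc (r + b)) B          ∎)
    where open ≡-Reasoning

  length-Ys : length Ys ≡ below (suc r) B
  length-Ys = begin
    length Ys          ≡⟨ above-all Ys (All.map proj₁ (freeColumns-free c)) ⟨
    above r Ys         ≡⟨ +-identityʳ _ ⟨
    above r Ys + 0     ≡⟨ subst (λ n → above n Ys + 0 ≡ below (suc n) B) (+-identityʳ r) (above-Ys z≤n) ⟩
    below (suc r) B    ∎
    where open ≡-Reasoning

  -- zip stops after length Ys = |B ∩ [1, r]| pairs, i.e. exactly after the rows in B.
  ρ : List Cell
  ρ = zip B Ys

  cell-row≤r : ∀ {a y} → (a , y) ∈ ρ → a < suc r
  cell-row≤r {a} {y} cell with a <? suc r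
  ... | yes a≤r = a≤r
  ... | no a≰r  = ⊥-elim (<-irrefl refl (begin-strict
    below (suc r) B  ≤⟨ below-mono B (≮⇒≥ a≰r) ⟩
    below a B        ≡⟨ zip-rank B Ys increasing Ys↓ cell ⟩
    above y Ys       <⟨ above-∈ Ys y∈Ys (proj₁ (All.lookup (freeColumns-free c) y∈Ys)) ⟩
    above r Ys       ≡⟨ above-all Ys (All.map proj₁ (freeColumns-free c)) ⟩
    length Ys        ≡⟨ length-Ys ⟩
    below (suc r) B  ∎))
    where
    open ≤-Reasoning
    y∈Ys : y ∈ Ys
    y∈Ys = proj₂ (∈-zip⁻ cell)

  column≤lam : ∀ k {y} → y ∈ Ys → above y Ys ≡ below (suc (toℕ k)) B → y ≤ r + lam S k
  column≤lam k {y} y∈Ys rank = ≮⇒≥ λ r+λₖ<y → <-irrefl refl (begin-strict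
    above y Ys + λₖ             <⟨ +-monoˡ-< λₖ (above-∈ Ys y∈Ys r+λₖ<y) ⟩
    above (r + λₖ) Ys + λₖ      ≡⟨ above-Ys (lam-≤c S k) ⟩
    below (suc (r + λₖ)) B      ≤⟨ lam-bound k ⟩
    λₖ + below (suc (toℕ k)) B  ≡⟨ cong (λₖ +_) rank ⟨
    λₖ + above y Ys             ≡⟨ +-comm λₖ _ ⟩
    above y Ys + λₖ             ∎)
    where
    open ≤-Reasoning
    λₖ : ℕ
    λₖ = lam S k

  mu<column : ∀ k {y} → y ∈ Ys → suc (above y Ys) ≡ below (suc (suc (toℕ k))) B → r + mu S k < y
  mu<column k {y} y∈Ys rank = ≰⇒> λ y≤r+μₖ → <-irrefl refl (begin-strict
    μₖ + above y Ys                 <⟨ +-monoʳ-< μₖ ≤-refl ⟩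
    μₖ + suc (above y Ys)           ≡⟨ cong (μₖ +_) rank ⟩
    μₖ + below (suc (suc (toℕ k))) B ≤⟨ mu-bound k ⟩
    below (suc (r + μₖ)) B          ≡⟨ above-Ys (≤-trans (<⇒≤ (row-nonempty S k)) (lam-≤c S k)) ⟨
    above (r + μₖ) Ys + μₖ          ≤⟨ +-monoˡ-≤ μₖ (above-anti Ys y≤r+μₖ) ⟩
    above y Ys + μₖ                 ≡⟨ +-comm _ μₖ ⟩
    μₖ + above y Ys                 ∎)
    where
    open ≤-Reasoning
    μₖ : ℕ
    μₖ = mu S k

  cell-in-shape : ∀ {p} → p ∈ ρ → InShape S p
  cell-in-shape {zero , y} cell = ⊥-elim (≤⇒≯ (proj₁ (All.lookup bounded (proj₁ (∈-zip⁻ cell)))) (s≤s z≤n))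
  cell-in-shape {suc a , y} cell = k , cong suc (sym toℕk≡a) , mu<column k y∈Ys rank₊ , column≤lam k y∈Ys rank
    where
    a<r : a < r
    a<r = ≤-pred (cell-row≤r cell)
    k : Fin r
    k = fromℕ< a<r
    toℕk≡a : toℕ k ≡ a
    toℕk≡a = toℕ-fromℕ< a<r
    y∈Ys : y ∈ Ys
    y∈Ys = proj₂ (∈-zip⁻ cell)
    rank : above y Ys ≡ below (suc (toℕ k)) B
    rank = trans (sym (zip-rank B Ys increasing Ys↓ cell)) (cong (λ n → below (suc n) B) (sym toℕk≡a))
    rank₊ : suc (above y Ys) ≡ below (suc (suc (toℕ k))) B
    rank₊ = trans (cong suc rank)
      (sym (below-suc-∈ B increasing (subst (λ n → suc n ∈ B) (sym toℕk≡a) (proj₁ (∈-zip⁻ cell)))))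

  placement : NonNestingRookPlacement S ρ
  placement = record
    { inShape     = cell-in-shape
    ; rowDistinct = zip-injectiveˡ B Ys increasing
    ; colDistinct = zip-injectiveʳ B Ys Ys↓
    ; nonNesting  = zip-nonNesting B Ys increasing Ys↓
    }

  row-rank<length : ∀ {x} → x ∈ B → x < suc r → below x B < length Ys
  row-rank<length {x} x∈B x≤r = begin-strict
    below x B        <⟨ ≤-reflexive (sym (below-suc-∈ B increasing x∈B)) ⟩
    below (suc x) B  ≤⟨ below-mono B x≤r ⟩
    below (suc r) B  ≡⟨ length-Ys ⟨
    length Ys        ∎
    where open ≤-Reasoning

  basis : ∀ x → (x ∈ B) ⇔ InRC r c ρ x
  basis x = mk⇔ to from
    where
    to : x ∈ B → InRC r c ρ x
    to x∈B with x <? suc r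
    ... | yes x≤r = let y , cell = ∈-zip⁺ˡ B Ys increasing x∈B (row-rank<length x∈B x≤r)
                    in inj₁ ((x , y) , cell , refl)
    ... | no x≰r  = inj₂ (≰⇒> (x≰r ∘ s≤s) , proj₂ (All.lookup bounded x∈B) , unoccupied)
      where
      unoccupied : ∀ p → p ∈ ρ → proj₂ p ≢ x
      unoccupied p cell refl = proj₂ (proj₂ (All.lookup (freeColumns-free c) (proj₂ (∈-zip⁻ cell)))) x∈B
    from : InRC r c ρ x → x ∈ B
    from (inj₁ (_ , cell , refl)) = proj₁ (∈-zip⁻ cell)
    from (inj₂ (r<x , x≤r+c , unoccupied)) with B? x
    ... | yes x∈B = x∈B
    ... | no x∉B  = let a , cell = ∈-zip⁺ʳ B |Ys|≤|B| (∈-freeColumns c r<x x≤r+c x∉B)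
                    in ⊥-elim (unoccupied (a , x) cell refl)
      where
      |Ys|≤|B| : length Ys ≤ length B
      |Ys|≤|B| = subst (_≤ length B) (sym length-Ys) (below≤length (suc r) B)

admissible⇒basis : ∀ {r c} (S : SkewShape r c) {B} → Admissible S B → IsRookBasis S B
admissible⇒basis S adm = Linked.AllPairs⇒Linked (Admissible.increasing adm) , ρ , placement , basis
  where open GreedyPlacement S adm

theorem3p17 : ∀ (r c : ℕ) (S : SkewShape r c) (I J : List ℕ) →
    IsRookBasis S I → IsRookBasis S J →
    IsRookBasis S (sort₁ I J) × IsRookBasis S (sort₂ I J)
theorem3p17 r c S I J I-basis J-basis =
  admissible⇒basis S (sort₁-admissible S I-adm J-adm) ,
  admissible⇒basis S (sort₂-admissible S I-adm J-adm)
  where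
  I-adm : Admissible S I
  I-adm = basis⇒admissible S I-basis
  J-adm : Admissible S J
  J-adm = basis⇒admissible S J-basis
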